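{- Let $n\ge1$ and let $Q_n$ be the graph whose vertices are the unit squares of $AD(n)$ lying in the quadrant $x\le0$, $y\ge0$, two squares adjacent iff they share an edge. Its distinguished vertices are the $2n-1$ squares $[-1,0]\times[j,j+1]$ ($0\le j\le n-1$) and $[i,i+1]\times[0,1]$ ($-n\le i\le -1$); the square $c=[-1,0]\times[0,1]$ is called the middle distinguished vertex. For a set $S$ of distinguished vertices let $M(Q_n-S)$ be the number of perfect matchings of $Q_n$ with $S$ deleted, and let $w(S)=2$ if $c\in S$ and $w(S)=1$ otherwise. Then \[\sum_{S}w(S)\,M(Q_n-S),\] the sum over all subsets $S$ of the distinguished vertices, equals the number of domino tilings of $AD(n)$ invariant under both $t$ and $r^2$.
   Context: $AD(n)$ is the union of all unit lattice squares $[i,i+1]\times[j,j+1]$ ($i,j\in\mathbb{Z}$) contained in $|x|+|y|\le n+1$; domino tilings cover it by $1\times2$ or $2\times1$ dominoes without gaps or overlaps. $t$ is the reflection across the line $x=0$ and $r^2$ is rotation by $180^\circ$ about the origin. -}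

module Defs where

open import Data.Bool using (Bool; true; false)
open import Data.Nat as ℕ using (ℕ; zero; suc; _∸_)
import Data.Nat.Properties as ℕP
open import Data.Integer as ℤ using (ℤ; +_; -[1+_]; ∣_∣)
import Data.Integer.Properties as ℤP
open import Data.Product using (Σ; _×_; _,_; proj₁; proj₂)
import Data.Product.Properties as ×P
open import Data.Sum using (_⊎_)
open import Data.List using (List; []; _∷_; _++_; map; filter; length; concatMap; upTo)
open import Data.Nat.ListAction using (sum)
open import Data.List.Relation.Unary.All as All using (All)
open import Data.List.Relation.Unary.Any as Any using (Any)
open import Relation.Nullary using (Dec; yes; no; ¬_)
open import Relation.Nullary.Decidable using (_×-dec_; _⊎-dec_; ¬?)
open import Relation.Binary.PropositionalEquality using (_≡_)
open import Relation.Unary using (Decidable)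

-- Unit lattice squares.  The square [i,i+1]×[j,j+1] is represented by
-- its lower-left corner (i , j).

Sq : Set
Sq = ℤ × ℤ

_≟Sq_ : (a b : Sq) → Dec (a ≡ b)
_≟Sq_ = ×P.≡-dec ℤ._≟_ ℤ._≟_

range : ℤ → ℕ → List ℤ
range lo k = map (λ m → lo ℤ.+ + m) (upTo k)

InDiamond : ℕ → ℤ → ℤ → Set
InDiamond n x y = ∣ x ∣ ℕ.+ ∣ y ∣ ℕ.≤ suc n

-- The square with lower-left corner (i , j) is contained in |x|+|y| ≤ n+1
-- iff its four corners are (the region is convex).
InAD : ℕ → Sq → Set
InAD n (i , j) =
  InDiamond n i j × InDiamond n (i ℤ.+ + 1) j ×
  InDiamond n i (j ℤ.+ + 1) × InDiamond n (i ℤ.+ + 1) (j ℤ.+ + 1)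

inAD? : (n : ℕ) → Decidable (InAD n)
inAD? n (i , j) =
  (_ ℕ.≤? _) ×-dec (_ ℕ.≤? _) ×-dec (_ ℕ.≤? _) ×-dec (_ ℕ.≤? _)

candidates : ℕ → List Sq
candidates n = concatMap (λ i → map (λ j → (i , j)) R) R
  where R = range -[1+ n ] (2 ℕ.* suc n)

ADsquares : ℕ → List Sq
ADsquares n = filter (inAD? n) (candidates n)

Domino : Set
Domino = Sq × Sq

_∈?_ : (a : Sq) (V : List Sq) → Dec (Any (a ≡_) V)
a ∈? V = Any.any? (a ≟Sq_) V

-- All dominoes inside the vertex set V (each listed exactly once:
-- a square together with its right neighbour or its upper neighbour).
dominoes : List Sq → List Domino
dominoes V = concatMap nbrs V
  where
  right up : Sq → Sq
  right (i , j) = (i ℤ.+ + 1 , j)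
  up    (i , j) = (i , j ℤ.+ + 1)
  keep : Sq → Sq → List Domino
  keep a b with b ∈? V
  ... | yes _ = (a , b) ∷ []
  ... | no  _ = []
  nbrs : Sq → List Domino
  nbrs a = keep a (right a) ++ keep a (up a)

select : {A : Set} → List A → List Bool → List A
select []       _            = []
select (x ∷ xs) []           = []
select (x ∷ xs) (true  ∷ bs) = x ∷ select xs bs
select (x ∷ xs) (false ∷ bs) = select xs bs

allBits : ℕ → List (List Bool)
allBits zero    = [] ∷ []
allBits (suc k) = map (true ∷_) (allBits k) ++ map (false ∷_) (allBits k)

Covers : Domino → Sq → Set
Covers (a , b) v = (v ≡ a) ⊎ (v ≡ b)

covers? : (d : Domino) (v : Sq) → Dec (Covers d v)
covers? (a , b) v = (v ≟Sq a) ⊎-dec (v ≟Sq b)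

IsTiling : List Sq → List Domino → Set
IsTiling V T = All (λ v → length (filter (λ d → covers? d v) T) ≡ 1) V

isTiling? : (V : List Sq) → Decidable (IsTiling V)
isTiling? V T = All.all? (λ v → length (filter (λ d → covers? d v) T) ℕ.≟ 1) V

-- Perfect matchings of the induced grid graph on V (= domino tilings of
-- the region formed by the squares in V): subsets of the dominoes of V
-- (encoded as bit lists) covering every square exactly once.
PerfectMatching : List Sq → List Bool → Set
PerfectMatching V bs = IsTiling V (select (dominoes V) bs)

pm? : (V : List Sq) → Decidable (PerfectMatching V)
pm? V bs = isTiling? V (select (dominoes V) bs)

M : List Sq → ℕ
M V = length (filter (pm? V) (allBits (length (dominoes V))))

-- Symmetries.  t : (x , y) ↦ (-x , y) sends the square with corner
-- (i , j) to the one with corner (-i-1 , j); r² : (x , y) ↦ (-x , -y)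
-- sends it to (-i-1 , -j-1).

tSq : Sq → Sq
tSq (i , j) = (ℤ.- i ℤ.- + 1 , j)

r2Sq : Sq → Sq
r2Sq (i , j) = (ℤ.- i ℤ.- + 1 , ℤ.- j ℤ.- + 1)

mapDomino : (Sq → Sq) → Domino → Domino
mapDomino g (a , b) = (g a , g b)

SameDomino : Domino → Domino → Set
SameDomino (a , b) (a' , b') = ((a ≡ a') × (b ≡ b')) ⊎ ((a ≡ b') × (b ≡ a'))

sameDomino? : (d e : Domino) → Dec (SameDomino d e)
sameDomino? (a , b) (a' , b') =
  ((a ≟Sq a') ×-dec (b ≟Sq b')) ⊎-dec ((a ≟Sq b') ×-dec (b ≟Sq a'))

_∈D?_ : (d : Domino) (T : List Domino) → Dec (Any (SameDomino d) T)
d ∈D? T = Any.any? (sameDomino? d) T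

Invariant : (Sq → Sq) → List Domino → Set
Invariant g T =
  All (λ d → Any (SameDomino (mapDomino g d)) T) T ×
  All (λ d → Any (λ e → SameDomino d (mapDomino g e)) T) T

invariant? : (g : Sq → Sq) → Decidable (Invariant g)
invariant? g T =
  All.all? (λ d → mapDomino g d ∈D? T) T ×-dec
  All.all? (λ d → Any.any? (λ e → sameDomino? d (mapDomino g e)) T) T

SymTiling : ℕ → List Bool → Set
SymTiling n bs =
  PerfectMatching (ADsquares n) bs ×
  Invariant tSq  (select (dominoes (ADsquares n)) bs) ×
  Invariant r2Sq (select (dominoes (ADsquares n)) bs)

symTiling? : (n : ℕ) → Decidable (SymTiling n)
symTiling? n bs =
  pm? (ADsquares n) bs ×-dec invariant? tSq T ×-dec invariant? r2Sq T
  where T = select (dominoes (ADsquares n)) bs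

numSymTilings : ℕ → ℕ
numSymTilings n =
  length (filter (symTiling? n) (allBits (length (dominoes (ADsquares n)))))

-- The graph Q_n: squares of AD(n) inside the quadrant x ≤ 0, y ≥ 0,
-- i.e. with i + 1 ≤ 0 and j ≥ 0.

InQuadrant : Sq → Set
InQuadrant (i , j) = (i ℤ.+ + 1 ℤ.≤ + 0) × (+ 0 ℤ.≤ j)

inQuadrant? : Decidable InQuadrant
inQuadrant? (i , j) = (_ ℤ.≤? _) ×-dec (_ ℤ.≤? _)

Qsquares : ℕ → List Sq
Qsquares n = filter inQuadrant? (ADsquares n)

cSq : Sq
cSq = (ℤ.-[1+ 0 ] , + 0)

-- the 2n-1 distinguished vertices, each listed once:
-- (-1 , j) for 0 ≤ j ≤ n-1, then (i , 0) for -n ≤ i ≤ -2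
distinguished : ℕ → List Sq
distinguished n =
  map (λ j → (-[1+ 0 ] , + j)) (upTo n) ++
  map (λ k → (-[1+ suc k ] , + 0)) (upTo (n ∸ 1))

deleteSet : List Sq → List Sq → List Sq
deleteSet S V = filter (λ v → ¬? (v ∈? S)) V

w : List Sq → ℕ
w S with cSq ∈? S
... | yes _ = 2
... | no  _ = 1

weightedSum : ℕ → ℕ
weightedSum n =
  sum (map (λ bs → let S = select (distinguished n) bs in
                   w S ℕ.* M (deleteSet S (Qsquares n)))
           (allBits (length (distinguished n))))

{-# OPTIONS --safe #-}
module Submission where

-- A tiling invariant under t and r² is invariant under the reflections t and u in both
-- axes, so it is determined by its restriction to the quadrant: the dominoes inside it
-- form a matching of the squares whose domino does not cross an axis, and a domino
-- crossing an axis is its own mirror image, hence covers a distinguished square.  The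
-- crossing direction is forced except at c, which touches both axes; this is the weight 2.
-- Conversely, a pair of adjacent squares is a domino of the unfolded tiling iff it folds
-- to an edge of the matching, or to a single chosen square in the admissible direction.

open import Defs
open import Data.Nat using (ℕ; _≤_)
open import Relation.Binary.PropositionalEquality using (_≡_)
open import Data.Bool as Bool using (Bool; true; false; not)
open import Data.Nat as ℕ using (zero; suc; _<_; z≤n; s≤s; _+_; _*_; _∸_)
import Data.Nat.Properties as ℕP
open import Data.Nat.ListAction using (sum)
open import Data.Integer as ℤ using (ℤ; +_; -[1+_]; ∣_∣)
import Data.Integer.Properties as ℤP
import Algebra.Properties.AbelianGroup ℤP.+-0-abelianGroup as ℤG
open import Data.Fin using (Fin)
open import Data.Fin.Properties using (injective⇒≤)
open import Data.Product using (∃; _×_; _,_; proj₁; proj₂)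
import Data.Product.Properties as ×P
open import Data.Sum using (_⊎_; inj₁; inj₂)
open import Data.Empty using (⊥-elim)
open import Data.List
  using (List; []; _∷_; map; filter; length; concatMap; upTo; lookup; cartesianProduct)
open import Data.List.Properties using (length-map; length-++; ∷-injective; concatMap-cong; map-cong)
open import Data.List.Membership.Propositional using (_∈_; _∉_; find; lose)
open import Data.List.Membership.Propositional.Properties
  using ( ∈-map⁺; ∈-map⁻; ∈-++⁺ˡ; ∈-++⁺ʳ; ∈-++⁻; ∈-concatMap⁺; ∈-concatMap⁻; ∈-filter⁺; ∈-filter⁻
        ; ∈-lookup; ∈-upTo⁺; ∈-upTo⁻; ∈-cartesianProduct⁺; ∈-cartesianProduct⁻ )
import Data.List.Membership.DecPropositional as DecMembership
open import Data.List.Relation.Unary.All as All using ([]; _∷_)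
open import Data.List.Relation.Unary.AllPairs using ([]; _∷_)
open import Data.List.Relation.Unary.Any as Any using (Any; here; there)
open import Data.List.Relation.Unary.Any.Properties using (lookup-index)
open import Data.List.Relation.Unary.Unique.Propositional using (Unique)
import Data.List.Relation.Unary.Unique.Propositional.Properties as Uniq
open import Function using (_∘_; flip)
open import Relation.Nullary using (Dec; yes; no; ¬_; does; contradiction)
open import Relation.Nullary.Decidable using (_⊎-dec_; _×-dec_; ¬?; dec-true; dec-false)
open import Relation.Unary using (Decidable)
open import Relation.Binary.PropositionalEquality
  using (_≢_; refl; sym; trans; cong; cong₂; subst; subst₂)

-- A symmetric tiling and a matching of the reduced quadrant are bit lists over different domino
-- lists, and the second of these lists varies with `S`. Inverse functions would have to compare bit
-- lists across changing regions. The two sides are therefore linked by a relation, `Unfolds`, which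
-- only compares edges between adjacent squares; equal counts follow once it is total and injective
-- in both directions. The weighted sum becomes the length of one list of triples (subset, mark,
-- matching). The shape of the diamond enters only through its closure under the two reflections and
-- the fact that the distinguished squares are exactly its quadrant squares with a side on an axis.

private
  variable
    A B : Set

-- Counting lists through relations

Unique-lookup-injective : {xs : List A} → Unique xs →
  ∀ {i j} → lookup xs i ≡ lookup xs j → i ≡ j
Unique-lookup-injective {xs = x ∷ xs} (p ∷ u) {Fin.zero}  {Fin.zero}  e = refl
Unique-lookup-injective {xs = x ∷ xs} (p ∷ u) {Fin.zero}  {Fin.suc j} e =
  ⊥-elim (All.lookup p (∈-lookup j) e)
Unique-lookup-injective {xs = x ∷ xs} (p ∷ u) {Fin.suc i} {Fin.zero}  e =
  ⊥-elim (All.lookup p (∈-lookup i) (sym e))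
Unique-lookup-injective {xs = x ∷ xs} (p ∷ u) {Fin.suc i} {Fin.suc j} e =
  cong Fin.suc (Unique-lookup-injective u e)

-- Choosing a related position in `ys` for each position in `xs` gives a map of finite index types,
-- injective because `R` is and `xs` has no repetitions.
length-≤-by : {xs : List A} {ys : List B} (R : A → B → Set) → Unique xs →
  (∀ {x} → x ∈ xs → ∃ λ y → y ∈ ys × R x y) →
  (∀ {x x' y} → x ∈ xs → x' ∈ xs → R x y → R x' y → x ≡ x') →
  length xs ≤ length ys
length-≤-by {xs = xs} {ys} R u total inj = injective⇒≤ {f = f} f-injective
  where
  image : ∀ i → ∃ λ y → y ∈ ys × R (lookup xs i) y
  image i = total (∈-lookup i)
  f : Fin (length xs) → Fin (length ys)
  f i = Any.index (proj₁ (proj₂ (image i)))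
  related : ∀ i → R (lookup xs i) (lookup ys (f i))
  related i = subst (R (lookup xs i)) (lookup-index (proj₁ (proj₂ (image i)))) (proj₂ (proj₂ (image i)))
  f-injective : ∀ {i j} → f i ≡ f j → i ≡ j
  f-injective {i} {j} e = Unique-lookup-injective u
    (inj (∈-lookup i) (∈-lookup j) (related i)
         (subst (λ k → R (lookup xs j) (lookup ys k)) (sym e) (related j)))

length-≡-by : {xs : List A} {ys : List B} (R : A → B → Set) → Unique xs → Unique ys →
  (∀ {x} → x ∈ xs → ∃ λ y → y ∈ ys × R x y) →
  (∀ {y} → y ∈ ys → ∃ λ x → x ∈ xs × R x y) →
  (∀ {x x' y} → x ∈ xs → x' ∈ xs → R x y → R x' y → x ≡ x') →
  (∀ {x y y'} → y ∈ ys → y' ∈ ys → R x y → R x y' → y ≡ y') →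
  length xs ≡ length ys
length-≡-by R uxs uys totalˡ totalʳ injˡ injʳ =
  ℕP.≤-antisym (length-≤-by R uxs totalˡ injˡ)
               (length-≤-by (flip R) uys totalʳ injʳ)

length-concatMap : (f : A → List B) (xs : List A) →
  length (concatMap f xs) ≡ sum (map (length ∘ f) xs)
length-concatMap f []       = refl
length-concatMap f (x ∷ xs) =
  trans (length-++ (f x)) (cong (length (f x) ℕ.+_) (length-concatMap f xs))

-- `key` recovers the block that an element comes from, so different blocks are disjoint.
concatMap-Unique : {f : A → List B} (key : B → A) → (∀ {x y} → y ∈ f x → key y ≡ x) →
  (∀ x → Unique (f x)) → {xs : List A} → Unique xs → Unique (concatMap f xs)
concatMap-Unique key k uf {[]}     []      = []
concatMap-Unique {f = f} key k uf {x ∷ xs} (p ∷ u) =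
  Uniq.++⁺ (uf x) (concatMap-Unique key k uf u) disjoint
  where
  disjoint : ∀ {y} → ¬ (y ∈ f x × y ∈ concatMap f xs)
  disjoint (m , m') with find (∈-concatMap⁻ f {xs = xs} m')
  ... | x' , x'∈ , m'' = All.lookup p x'∈ (trans (sym (k m)) (k m''))

-- Bit lists as subsets

∈-allBits⁺ : ∀ bs → bs ∈ allBits (length bs)
∈-allBits⁺ []           = here refl
∈-allBits⁺ (true  ∷ bs) = ∈-++⁺ˡ (∈-map⁺ (true ∷_) (∈-allBits⁺ bs))
∈-allBits⁺ (false ∷ bs) = ∈-++⁺ʳ (map (true ∷_) (allBits (length bs))) (∈-map⁺ (false ∷_) (∈-allBits⁺ bs))

∈-allBits⁻ : ∀ k {bs} → bs ∈ allBits k → length bs ≡ k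
∈-allBits⁻ zero    (here refl) = refl
∈-allBits⁻ (suc k) m with ∈-++⁻ (map (true ∷_) (allBits k)) m
... | inj₁ m' with ∈-map⁻ _ m'
...   | _ , q , refl = cong suc (∈-allBits⁻ k q)
∈-allBits⁻ (suc k) m | inj₂ m' with ∈-map⁻ _ m'
...   | _ , q , refl = cong suc (∈-allBits⁻ k q)

allBits-Unique : ∀ k → Unique (allBits k)
allBits-Unique zero    = [] ∷ []
allBits-Unique (suc k) =
  Uniq.++⁺ (Uniq.map⁺ (proj₂ ∘ ∷-injective) (allBits-Unique k))
           (Uniq.map⁺ (proj₂ ∘ ∷-injective) (allBits-Unique k)) disjoint
  where
  disjoint : ∀ {bs} → ¬ (bs ∈ map (true ∷_) (allBits k) × bs ∈ map (false ∷_) (allBits k))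
  disjoint (m , m') with ∈-map⁻ _ m | ∈-map⁻ _ m'
  ... | _ , _ , refl | _ , _ , ()

select-⊆ : (xs : List A) (bs : List Bool) {x : A} → x ∈ select xs bs → x ∈ xs
select-⊆ (y ∷ xs) (true  ∷ bs) (here e)  = here e
select-⊆ (y ∷ xs) (true  ∷ bs) (there m) = there (select-⊆ xs bs m)
select-⊆ (y ∷ xs) (false ∷ bs) m         = there (select-⊆ xs bs m)

select-Unique : {xs : List A} → Unique xs → ∀ bs → Unique (select xs bs)
select-Unique []      bs           = []
select-Unique (p ∷ u) []           = []
select-Unique {xs = x ∷ xs} (p ∷ u) (true ∷ bs) =
  All.tabulate (λ m → All.lookup p (select-⊆ xs bs m)) ∷ select-Unique u bs
select-Unique (p ∷ u) (false ∷ bs) = select-Unique u bs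

-- The head of `xs` does not recur, so its membership in the selection reads off the first bit. The
-- length conditions exclude padded or truncated bit lists, which could select the same elements.
select-injective : {xs : List A} → Unique xs → ∀ bs bs' →
  length bs ≡ length xs → length bs' ≡ length xs →
  (∀ {x} → x ∈ select xs bs → x ∈ select xs bs') →
  (∀ {x} → x ∈ select xs bs' → x ∈ select xs bs) → bs ≡ bs'
select-injective [] [] [] _ _ _ _ = refl
select-injective {xs = x ∷ xs} (p ∷ u) (true ∷ bs) (true ∷ bs') l l' f g =
  cong (true ∷_) (select-injective u bs bs' (ℕP.suc-injective l) (ℕP.suc-injective l')
    (λ m → strip (f (there m)) (All.lookup p (select-⊆ xs bs m)))
    (λ m → strip (g (there m)) (All.lookup p (select-⊆ xs bs' m))))
  where
  strip : ∀ {y zs} → y ∈ x ∷ zs → x ≢ y → y ∈ zs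
  strip (here e)  n = ⊥-elim (n (sym e))
  strip (there m) n = m
select-injective {xs = x ∷ xs} (p ∷ u) (true ∷ bs) (false ∷ bs') l l' f g =
  ⊥-elim (All.lookup p (select-⊆ xs bs' (f (here refl))) refl)
select-injective {xs = x ∷ xs} (p ∷ u) (false ∷ bs) (true ∷ bs') l l' f g =
  ⊥-elim (All.lookup p (select-⊆ xs bs (g (here refl))) refl)
select-injective (p ∷ u) (false ∷ bs) (false ∷ bs') l l' f g =
  cong (false ∷_) (select-injective u bs bs' (ℕP.suc-injective l) (ℕP.suc-injective l') f g)

indicator : {P : A → Set} → Decidable P → List A → List Bool
indicator P? = map (λ x → does (P? x))

select-indicator : {P : A → Set} (P? : Decidable P) (xs : List A) →
  select xs (indicator P? xs) ≡ filter P? xs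
select-indicator P? []       = refl
select-indicator P? (x ∷ xs) with does (P? x)
... | true  = cong (x ∷_) (select-indicator P? xs)
... | false = select-indicator P? xs

∈-select-indicator⁺ : {P : A → Set} (P? : Decidable P) {xs : List A} {x : A} →
  x ∈ xs → P x → x ∈ select xs (indicator P? xs)
∈-select-indicator⁺ P? {xs} m p =
  subst (_ ∈_) (sym (select-indicator P? xs)) (∈-filter⁺ P? m p)

∈-select-indicator⁻ : {P : A → Set} (P? : Decidable P) {xs : List A} {x : A} →
  x ∈ select xs (indicator P? xs) → x ∈ xs × P x
∈-select-indicator⁻ P? {xs} m = ∈-filter⁻ P? (subst (_ ∈_) (select-indicator P? xs) m)

indicator-∈-allBits : {P : A → Set} (P? : Decidable P) (xs : List A) →
  indicator P? xs ∈ allBits (length xs)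
indicator-∈-allBits P? xs =
  subst (λ k → indicator P? xs ∈ allBits k) (length-map _ xs) (∈-allBits⁺ (indicator P? xs))

length-1⁻ : {xs : List A} → length xs ≡ 1 → ∃ λ x → x ∈ xs × (∀ {y} → y ∈ xs → y ≡ x)
length-1⁻ {xs = x ∷ []} refl = x , here refl , λ { (here e) → e }

length-1⁺ : {xs : List A} {x : A} → Unique xs → x ∈ xs → (∀ {y} → y ∈ xs → y ≡ x) → length xs ≡ 1
length-1⁺ {xs = y ∷ []}     u m f = refl
length-1⁺ {xs = y ∷ z ∷ xs} ((n ∷ _) ∷ _) m f =
  ⊥-elim (n (trans (f (here refl)) (sym (f (there (here refl))))))

-- Coordinates under reflection

-- `i` stands for the interval [i,i+1], whose mirror image starts at -i-1.
mirror : ℤ → ℤ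
mirror i = ℤ.- i ℤ.- + 1

uSq : Sq → Sq
uSq (i , j) = (i , mirror j)

-- The distance from 0 to the interval [i,i+1].
norm : ℤ → ℕ
norm (+ a)    = a
norm -[1+ a ] = a

mirror-+ : ∀ a → mirror (+ a) ≡ -[1+ a ]
mirror-+ zero    = refl
mirror-+ (suc a) = cong (-[1+_] ∘ suc) (ℕP.+-identityʳ a)

mirror-involutive : ∀ i → mirror (mirror i) ≡ i
mirror-involutive (+ a)    = cong mirror (mirror-+ a)
mirror-involutive -[1+ a ] = mirror-+ a

norm-mirror : ∀ i → norm (mirror i) ≡ norm i
norm-mirror (+ a)    = cong norm (mirror-+ a)
norm-mirror -[1+ a ] = refl

i+1-1≡i : ∀ i → i ℤ.+ + 1 ℤ.- + 1 ≡ i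
i+1-1≡i i = trans (ℤP.+-assoc i (+ 1) (ℤ.- + 1)) (ℤP.+-identityʳ i)

i-1+1≡i : ∀ i → i ℤ.- + 1 ℤ.+ + 1 ≡ i
i-1+1≡i i = trans (ℤP.+-assoc i (ℤ.- + 1) (+ 1)) (ℤP.+-identityʳ i)

mirror-step : ∀ i → mirror (i ℤ.+ + 1) ℤ.+ + 1 ≡ mirror i
mirror-step i = trans (i-1+1≡i _) (ℤP.neg-distrib-+ i (+ 1))

i+1≢i : ∀ i → i ℤ.+ + 1 ≢ i
i+1≢i i e = contradiction (ℤG.∙-cancelˡ i (+ 1) (+ 0) (trans e (sym (ℤP.+-identityʳ i)))) λ ()

i+1+1≢i : ∀ i → i ℤ.+ + 1 ℤ.+ + 1 ≢ i
i+1+1≢i i e = contradiction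
  (ℤG.∙-cancelˡ i (+ 2) (+ 0) (trans (sym (ℤP.+-assoc i (+ 1) (+ 1))) (trans e (sym (ℤP.+-identityʳ i))))) λ ()

tSq-involutive : ∀ v → tSq (tSq v) ≡ v
tSq-involutive (i , j) = cong (_, j) (mirror-involutive i)

uSq-involutive : ∀ v → uSq (uSq v) ≡ v
uSq-involutive (i , j) = cong (i ,_) (mirror-involutive j)

-- Adjacency

right up : Sq → Sq
right (i , j) = (i ℤ.+ + 1 , j)
up    (i , j) = (i , j ℤ.+ + 1)

_⋖_ : Sq → Sq → Set
a ⋖ b = b ≡ right a ⊎ b ≡ up a

Adj : Sq → Sq → Set
Adj a b = a ⋖ b ⊎ b ⋖ a

Adj-sym : ∀ {a b} → Adj a b → Adj b a
Adj-sym (inj₁ p) = inj₂ p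
Adj-sym (inj₂ p) = inj₁ p

⋖-asym : ∀ {a b} → a ⋖ b → ¬ (b ⋖ a)
⋖-asym {i , j} (inj₁ refl) (inj₁ e) = i+1+1≢i i (sym (cong proj₁ e))
⋖-asym {i , j} (inj₁ refl) (inj₂ e) = i+1≢i i (sym (cong proj₁ e))
⋖-asym {i , j} (inj₂ refl) (inj₁ e) = i+1≢i i (sym (cong proj₁ e))
⋖-asym {i , j} (inj₂ refl) (inj₂ e) = i+1+1≢i j (sym (cong proj₂ e))

Adj-irrefl : ∀ {a} → ¬ Adj a a
Adj-irrefl (inj₁ p) = ⋖-asym p p
Adj-irrefl (inj₂ p) = ⋖-asym p p

-- The reflection swaps the ends of a horizontal domino and keeps the order of a vertical one, so
-- only the symmetric relation `Adj` survives.
⋖-tSq : ∀ {a b} → a ⋖ b → Adj (tSq a) (tSq b)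
⋖-tSq {i , j} (inj₁ refl) = inj₂ (inj₁ (cong (_, j) (sym (mirror-step i))))
⋖-tSq {i , j} (inj₂ refl) = inj₁ (inj₂ refl)

⋖-uSq : ∀ {a b} → a ⋖ b → Adj (uSq a) (uSq b)
⋖-uSq {i , j} (inj₁ refl) = inj₁ (inj₁ refl)
⋖-uSq {i , j} (inj₂ refl) = inj₂ (inj₂ (cong (i ,_) (sym (mirror-step j))))

Adj-tSq : ∀ {a b} → Adj a b → Adj (tSq a) (tSq b)
Adj-tSq (inj₁ p) = ⋖-tSq p
Adj-tSq (inj₂ p) = Adj-sym (⋖-tSq p)

Adj-uSq : ∀ {a b} → Adj a b → Adj (uSq a) (uSq b)
Adj-uSq (inj₁ p) = ⋖-uSq p
Adj-uSq (inj₂ p) = Adj-sym (⋖-uSq p)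

-- The quadrant as a fundamental domain

data Quad : Sq → Set where
  quad : ∀ a b → Quad (-[1+ a ] , + b)

-- The quadrant representative of the orbit under `tSq` and `uSq`.
fold : Sq → Sq
fold (i , j) = (-[1+ norm i ] , + norm j)

fold-quad : ∀ {v} → Quad v → fold v ≡ v
fold-quad (quad a b) = refl

fold-tSq : ∀ v → fold (tSq v) ≡ fold v
fold-tSq (i , j) = cong (λ a → (-[1+ a ] , + norm j)) (norm-mirror i)

fold-uSq : ∀ v → fold (uSq v) ≡ fold v
fold-uSq (i , j) = cong (λ b → (-[1+ norm i ] , + b)) (norm-mirror j)

quad-wlog : {Z : Sq → Set} → (∀ v → Z v → Z (tSq v)) → (∀ v → Z v → Z (uSq v)) →
  (∀ {v} → Quad v → Z v) → ∀ v → Z v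
quad-wlog {Z} zt zu zq (+ a , + b)       = zt _ (zq (quad a b))
quad-wlog {Z} zt zu zq (-[1+ a ] , + b)    = zq (quad a b)
quad-wlog {Z} zt zu zq (+ a , -[1+ b ])    =
  subst Z (cong (+ a ,_) (mirror-+ b)) (zu _ (zt _ (zq (quad a b))))
quad-wlog {Z} zt zu zq (-[1+ a ] , -[1+ b ]) =
  subst Z (cong (-[1+ a ] ,_) (mirror-+ b)) (zu _ (zq (quad a b)))

¬Quad-tSq : ∀ {v} → Quad v → ¬ Quad (tSq v)
¬Quad-tSq (quad a b) ()

¬Quad-uSq : ∀ {v} → Quad v → ¬ Quad (uSq v)
¬Quad-uSq (quad a zero)    ()
¬Quad-uSq (quad a (suc b)) ()

tSq≢uSq : ∀ {v} → Quad v → tSq v ≢ uSq v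
tSq≢uSq (quad a b) ()

data Neighbour : Sq → Sq → Set where
  inside  : ∀ {v w} → Quad w → Neighbour v w
  acrossX : ∀ b → Neighbour (-[1+ 0 ] , + b) (tSq (-[1+ 0 ] , + b))
  acrossY : ∀ a → Neighbour (-[1+ a ] , + 0) (uSq (-[1+ a ] , + 0))

-- The quadrant can be left only to the right from column -1 or downwards from row 0, and either
-- step lands on the mirror image in that axis.
neighbour : ∀ {v w} → Quad v → Adj v w → Neighbour v w
neighbour (quad zero b)    (inj₁ (inj₁ refl)) = acrossX b
neighbour (quad (suc a) b) (inj₁ (inj₁ refl)) = inside (quad a b)
neighbour (quad a b)       (inj₁ (inj₂ refl)) = inside (quad a (b + 1))
neighbour {w = i , j} (quad a b) (inj₂ (inj₁ e)) =
  subst (Neighbour _) (sym (cong₂ _,_ left (sym (cong proj₂ e)))) (inside (quad (suc (a + 0)) b))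
  where
  left : i ≡ -[1+ a ] ℤ.- + 1
  left = trans (sym (i+1-1≡i i)) (cong (ℤ._- + 1) (sym (cong proj₁ e)))
neighbour {w = i , j} (quad a b) (inj₂ (inj₂ e)) =
  subst (Neighbour _) (sym (cong₂ _,_ (sym (cong proj₁ e)) down)) (below b)
  where
  down : j ≡ + b ℤ.- + 1
  down = trans (sym (i+1-1≡i j)) (cong (ℤ._- + 1) (sym (cong proj₂ e)))
  below : ∀ b → Neighbour (-[1+ a ] , + b) (-[1+ a ] , + b ℤ.- + 1)
  below zero    = acrossY a
  below (suc b) = inside (quad a b)

Adj-acrossX : ∀ b → Adj (-[1+ 0 ] , + b) (tSq (-[1+ 0 ] , + b))
Adj-acrossX b = inj₁ (inj₁ refl)

Adj-acrossY : ∀ a → Adj (-[1+ a ] , + 0) (uSq (-[1+ a ] , + 0))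
Adj-acrossY a = inj₂ (inj₂ refl)

-- The Aztec diamond

m+1≡ : ∀ m → m + 1 ≡ suc m
m+1≡ m = ℕP.+-comm m 1

∣i∣≤1+norm : ∀ i → ∣ i ∣ ≤ suc (norm i)
∣i∣≤1+norm (+ a)    = ℕP.n≤1+n a
∣i∣≤1+norm -[1+ a ] = ℕP.≤-refl

∣-[1+a]+1∣ : ∀ a → ∣ -[1+ a ] ℤ.+ + 1 ∣ ≡ a
∣-[1+a]+1∣ zero    = refl
∣-[1+a]+1∣ (suc a) = refl

∣i+1∣≤1+norm : ∀ i → ∣ i ℤ.+ + 1 ∣ ≤ suc (norm i)
∣i+1∣≤1+norm (+ a)    = ℕP.≤-reflexive (m+1≡ a)
∣i+1∣≤1+norm -[1+ a ] = ℕP.≤-trans (ℕP.≤-reflexive (∣-[1+a]+1∣ a)) (ℕP.n≤1+n a)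

-- The corner farthest from the origin has coordinates of absolute value `norm i + 1` and
-- `norm j + 1`; their sum is at most n+1 exactly when this inequality holds.
Small : ℕ → Sq → Set
Small n (i , j) = norm i + norm j < n

Small-tSq : ∀ {n} v → Small n v → Small n (tSq v)
Small-tSq {n} (i , j) = subst (λ a → a + norm j < n) (sym (norm-mirror i))

Small-uSq : ∀ {n} v → Small n v → Small n (uSq v)
Small-uSq {n} (i , j) = subst (λ b → norm i + b < n) (sym (norm-mirror j))

InAD⇒Small : ∀ {n} v → InAD n v → Small n v
InAD⇒Small {n} (+ a , + b) (_ , _ , _ , p) = ℕP.≤-pred (subst (_≤ suc n)
  (trans (cong₂ _+_ (m+1≡ a) (m+1≡ b)) (cong suc (ℕP.+-suc a b))) p)
InAD⇒Small {n} (+ a , -[1+ b ]) (_ , p , _ , _) = ℕP.≤-pred (subst (_≤ suc n)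
  (trans (cong (_+ suc b) (m+1≡ a)) (cong suc (ℕP.+-suc a b))) p)
InAD⇒Small {n} (-[1+ a ] , + b) (_ , _ , p , _) = ℕP.≤-pred (subst (_≤ suc n)
  (trans (cong (λ x → suc a + x) (m+1≡ b)) (cong suc (ℕP.+-suc a b))) p)
InAD⇒Small {n} (-[1+ a ] , -[1+ b ]) (p , _) = ℕP.≤-pred (subst (_≤ suc n)
  (cong suc (ℕP.+-suc a b)) p)

Small⇒InAD : ∀ {n} v → Small n v → InAD n v
Small⇒InAD {n} (i , j) s =
    bound (∣i∣≤1+norm i) (∣i∣≤1+norm j) , bound (∣i+1∣≤1+norm i) (∣i∣≤1+norm j)
  , bound (∣i∣≤1+norm i) (∣i+1∣≤1+norm j) , bound (∣i+1∣≤1+norm i) (∣i+1∣≤1+norm j)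
  where
  bound : ∀ {x y} → x ≤ suc (norm i) → y ≤ suc (norm j) → x + y ≤ suc n
  bound p q = ℕP.≤-trans (ℕP.+-mono-≤ p q)
    (s≤s (ℕP.≤-trans (ℕP.≤-reflexive (ℕP.+-suc (norm i) (norm j))) s))

∈-range : ∀ n i → norm i < n → i ∈ range -[1+ n ] (2 ℕ.* suc n)
∈-range n i p = subst (_∈ range -[1+ n ] (2 ℕ.* suc n)) (proj₂ (proj₂ (offset i p)))
  (∈-map⁺ _ (∈-upTo⁺ (proj₁ (proj₂ (offset i p)))))
  where
  offset : ∀ i → norm i < n → ∃ λ m → m < 2 ℕ.* suc n × -[1+ n ] ℤ.+ + m ≡ i
  -- The list starts at -(n+1), so the coordinate a has offset n+1+a and -(a+1) has offset n-a.
  offset (+ a) p = suc n + a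
    , ℕP.+-monoʳ-< (suc n) (ℕP.<-trans p (subst (n <_) (sym (ℕP.+-identityʳ (suc n))) (ℕP.n<1+n n)))
    , trans (ℤP.⊖-≥ (ℕP.m≤m+n (suc n) a)) (cong +_ (ℕP.m+n∸m≡n (suc n) a))
  offset -[1+ a ] p = n ∸ a
    , ℕP.≤-trans (s≤s (ℕP.m∸n≤m n a)) (ℕP.m≤m+n (suc n) (suc n + 0))
    , trans (cong (λ x → (n ∸ a) ℤ.⊖ suc x) (sym (ℕP.m∸n+n≡m (ℕP.<⇒≤ p))))
        (trans (cong ((n ∸ a) ℤ.⊖_) (sym (ℕP.+-suc (n ∸ a) a)))
          (trans (ℤP.⊖-≤ (ℕP.m≤m+n (n ∸ a) (suc a))) (cong (λ x → ℤ.- + x) (ℕP.m+n∸m≡n (n ∸ a) (suc a)))))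

∈-AD⁺ : ∀ {n} v → Small n v → v ∈ ADsquares n
∈-AD⁺ {n} v@(i , j) s = ∈-filter⁺ (inAD? n)
  (∈-concatMap⁺ (λ i → map (i ,_) (range -[1+ n ] (2 ℕ.* suc n))) (lose (∈-range n i (ℕP.≤-<-trans (ℕP.m≤m+n (norm i) (norm j)) s))
    (∈-map⁺ (i ,_) (∈-range n j (ℕP.≤-<-trans (ℕP.m≤n+m (norm j) (norm i)) s)))))
  (Small⇒InAD v s)

∈-AD⁻ : ∀ {n v} → v ∈ ADsquares n → Small n v
∈-AD⁻ {n} {v} m = InAD⇒Small v (proj₂ (∈-filter⁻ (inAD? n) {xs = candidates n} m))

AD-Unique : ∀ n → Unique (ADsquares n)
AD-Unique n = Uniq.filter⁺ (inAD? n)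
  (concatMap-Unique proj₁ (λ m → cong proj₁ (proj₂ (proj₂ (∈-map⁻ _ m))))
    (λ i → Uniq.map⁺ (cong proj₂) range-Unique) range-Unique)
  where
  range-Unique : Unique (range -[1+ n ] (2 ℕ.* suc n))
  range-Unique = Uniq.map⁺ (λ {x} {y} → ℤP.+-injective ∘ ℤG.∙-cancelˡ -[1+ n ] (+ x) (+ y)) (Uniq.upTo⁺ _)

InQuadrant⇒Quad : ∀ v → InQuadrant v → Quad v
InQuadrant⇒Quad (-[1+ a ] , + b) p = quad a b
InQuadrant⇒Quad (+ a , j) (p , _) with subst (λ x → + x ℤ.≤ + 0) (m+1≡ a) p
... | ℤ.+≤+ ()

Quad⇒InQuadrant : ∀ {v} → Quad v → InQuadrant v
Quad⇒InQuadrant (quad zero b)    = ℤ.+≤+ z≤n , ℤ.+≤+ z≤n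
Quad⇒InQuadrant (quad (suc a) b) = ℤ.-≤+ , ℤ.+≤+ z≤n

∈-Q⁺ : ∀ {n v} → Quad v → v ∈ ADsquares n → v ∈ Qsquares n
∈-Q⁺ q m = ∈-filter⁺ inQuadrant? m (Quad⇒InQuadrant q)

∈-Q⁻ : ∀ {n v} → v ∈ Qsquares n → Quad v × v ∈ ADsquares n
∈-Q⁻ {n} {v} m with ∈-filter⁻ inQuadrant? {xs = ADsquares n} m
... | m' , q = InQuadrant⇒Quad v q , m'

data Dist (n : ℕ) : Sq → Set where
  column : ∀ b → b < n → Dist n (-[1+ 0 ] , + b)
  row    : ∀ a → suc a < n → Dist n (-[1+ suc a ] , + 0)

∈-distinguished⁺ : ∀ {n v} → Dist n v → v ∈ distinguished n
∈-distinguished⁺ (column b p) = ∈-++⁺ˡ (∈-map⁺ _ (∈-upTo⁺ p))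
∈-distinguished⁺ {suc n} (row a (s≤s p)) = ∈-++⁺ʳ (map _ (upTo (suc n))) (∈-map⁺ _ (∈-upTo⁺ p))

∈-distinguished⁻ : ∀ {n v} → v ∈ distinguished n → Dist n v
∈-distinguished⁻ {n} m with ∈-++⁻ (map (λ j → (-[1+ 0 ] , + j)) (upTo n)) m
... | inj₁ m' with ∈-map⁻ _ m'
...   | b , q , refl = column b (∈-upTo⁻ q)
∈-distinguished⁻ {suc n} m | inj₂ m' with ∈-map⁻ _ m'
...   | a , q , refl = row a (s≤s (∈-upTo⁻ q))

distinguished-Unique : ∀ n → Unique (distinguished n)
distinguished-Unique n = Uniq.++⁺
  (Uniq.map⁺ (ℤP.+-injective ∘ cong proj₂) (Uniq.upTo⁺ n))
  (Uniq.map⁺ (ℕP.suc-injective ∘ ℤP.-[1+-injective ∘ cong proj₁) (Uniq.upTo⁺ (n ∸ 1)))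
  disjoint
  where
  disjoint : ∀ {v} → ¬ (v ∈ map (λ j → (-[1+ 0 ] , + j)) (upTo n) ×
                        v ∈ map (λ k → (-[1+ suc k ] , + 0)) (upTo (n ∸ 1)))
  disjoint (m , m') with ∈-map⁻ _ m | ∈-map⁻ _ m'
  ... | _ , _ , refl | _ , _ , ()

Dist⇒∈-AD : ∀ {n v} → Dist n v → v ∈ ADsquares n
Dist⇒∈-AD (column b p) = ∈-AD⁺ _ p
Dist⇒∈-AD {n} (row a p) = ∈-AD⁺ _ (subst (_< n) (sym (ℕP.+-identityʳ (suc a))) p)

Dist-column : ∀ {n b} → (-[1+ 0 ] , + b) ∈ ADsquares n → Dist n (-[1+ 0 ] , + b)
Dist-column m = column _ (∈-AD⁻ m)

-- For `a = 0` the square is `cSq`, which `distinguished` lists in its column half.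
Dist-row : ∀ {n} a → (-[1+ a ] , + 0) ∈ ADsquares n → Dist n (-[1+ a ] , + 0)
Dist-row zero    m = column 0 (∈-AD⁻ m)
Dist-row {n} (suc a) m = row a (subst (_< n) (ℕP.+-identityʳ (suc a)) (∈-AD⁻ m))

-- Dominoes and edges

-- The successor function local to the definition of dominoes has no name outside
-- it; unification recovers it.
dominoes-concatMap : ∀ V → ∃ λ f → dominoes V ≡ concatMap f V
dominoes-concatMap V = _ , refl

-- A filter form of the local successor function, so that membership follows from the general lemmas
-- on `filter`.
nbrs : List Sq → Sq → List Domino
nbrs V a = filter (λ d → proj₂ d ∈? V) ((a , right a) ∷ (a , up a) ∷ [])

dominoes≡ : ∀ V → dominoes V ≡ concatMap (nbrs V) V
dominoes≡ V = trans (proj₂ (dominoes-concatMap V)) (concatMap-cong pointwise V)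
  where
  pointwise : ∀ a → proj₁ (dominoes-concatMap V) a ≡ nbrs V a
  pointwise a with right a ∈? V
  pointwise a | yes _ with up a ∈? V
  ... | yes _ = refl
  ... | no _  = refl
  pointwise a | no _ with up a ∈? V
  ... | yes _ = refl
  ... | no _  = refl

∈-nbrs⁻ : ∀ V {a b c} → (b , c) ∈ nbrs V a → b ≡ a × c ∈ V × a ⋖ c
∈-nbrs⁻ V {a} m with ∈-filter⁻ (λ d → proj₂ d ∈? V) {xs = (a , right a) ∷ (a , up a) ∷ []} m
... | here refl         , c∈ = refl , c∈ , inj₁ refl
... | there (here refl) , c∈ = refl , c∈ , inj₂ refl

∈-nbrs⁺ : ∀ V {a c} → c ∈ V → a ⋖ c → (a , c) ∈ nbrs V a
∈-nbrs⁺ V c∈ (inj₁ refl) = ∈-filter⁺ (λ d → proj₂ d ∈? V) (here refl) c∈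
∈-nbrs⁺ V c∈ (inj₂ refl) = ∈-filter⁺ (λ d → proj₂ d ∈? V) (there (here refl)) c∈

∈-dominoes⁻ : ∀ V {a b} → (a , b) ∈ dominoes V → a ∈ V × b ∈ V × a ⋖ b
∈-dominoes⁻ V m
  with find (∈-concatMap⁻ (nbrs V) {xs = V} (subst (_ ∈_) (dominoes≡ V) m))
... | a , a∈ , m' with ∈-nbrs⁻ V m'
...   | refl , b∈ , a⋖b = a∈ , b∈ , a⋖b

∈-dominoes⁺ : ∀ V {a b} → a ∈ V → b ∈ V → a ⋖ b → (a , b) ∈ dominoes V
∈-dominoes⁺ V a∈ b∈ a⋖b = subst (_ ∈_) (sym (dominoes≡ V))
  (∈-concatMap⁺ (nbrs V) (lose a∈ (∈-nbrs⁺ V b∈ a⋖b)))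

dominoes-Unique : ∀ {V} → Unique V → Unique (dominoes V)
dominoes-Unique {V} u = subst Unique (sym (dominoes≡ V))
  (concatMap-Unique proj₁ (proj₁ ∘ ∈-nbrs⁻ V) nbrs-Unique u)
  where
  nbrs-Unique : ∀ a → Unique (nbrs V a)
  nbrs-Unique a = Uniq.filter⁺ (λ d → proj₂ d ∈? V)
    (((λ e → i+1≢i (proj₁ a) (cong (proj₁ ∘ proj₂) e)) ∷ []) ∷ [] ∷ [])

Edge : List Domino → Sq → Sq → Set
Edge T a b = (a , b) ∈ T ⊎ (b , a) ∈ T

abstract
  edge? : ∀ T a b → Dec (Edge T a b)
  edge? T a b = ((a , b) ∈ᵈ? T) ⊎-dec ((b , a) ∈ᵈ? T)
    where open DecMembership (×P.≡-dec _≟Sq_ _≟Sq_) renaming (_∈?_ to _∈ᵈ?_)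

Edge-sym : ∀ {T a b} → Edge T a b → Edge T b a
Edge-sym (inj₁ m) = inj₂ m
Edge-sym (inj₂ m) = inj₁ m

tiles : List Sq → List Bool → List Domino
tiles V bs = select (dominoes V) bs

∈-tiles⁻ : ∀ V bs {a b} → (a , b) ∈ tiles V bs → a ∈ V × b ∈ V × a ⋖ b
∈-tiles⁻ V bs m = ∈-dominoes⁻ V (select-⊆ (dominoes V) bs m)

edge⁻ : ∀ V bs {a b} → Edge (tiles V bs) a b → a ∈ V × b ∈ V × Adj a b
edge⁻ V bs (inj₁ m) with ∈-tiles⁻ V bs m
... | a∈ , b∈ , p = a∈ , b∈ , inj₁ p
edge⁻ V bs (inj₂ m) with ∈-tiles⁻ V bs m
... | b∈ , a∈ , p = a∈ , b∈ , inj₂ p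

edge-Adj : ∀ V bs {a b} → Edge (tiles V bs) a b → Adj a b
edge-Adj V bs e = proj₂ (proj₂ (edge⁻ V bs e))

-- An edge forgets the order of its ends, but only one order satisfies `⋖`, so equal edges mean
-- equal dominoes.
tiles-injective : ∀ {V} → Unique V → ∀ {bs bs'} →
  bs ∈ allBits (length (dominoes V)) → bs' ∈ allBits (length (dominoes V)) →
  (∀ {a b} → a ∈ V → b ∈ V → Adj a b → Edge (tiles V bs) a b → Edge (tiles V bs') a b) →
  (∀ {a b} → a ∈ V → b ∈ V → Adj a b → Edge (tiles V bs') a b → Edge (tiles V bs) a b) →
  bs ≡ bs'
tiles-injective {V} u {bs} {bs'} m m' f g =
  select-injective (dominoes-Unique u) bs bs' (∈-allBits⁻ _ m) (∈-allBits⁻ _ m')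
    (transfer bs bs' f) (transfer bs' bs g)
  where
  transfer : ∀ bs bs' →
    (∀ {a b} → a ∈ V → b ∈ V → Adj a b → Edge (tiles V bs) a b → Edge (tiles V bs') a b) →
    ∀ {d} → d ∈ tiles V bs → d ∈ tiles V bs'
  transfer bs bs' f d∈ with ∈-tiles⁻ V bs d∈
  ... | a∈ , b∈ , p with f a∈ b∈ (inj₁ p) (inj₁ d∈)
  ...   | inj₁ q = q
  ...   | inj₂ q = ⊥-elim (⋖-asym p (proj₂ (proj₂ (∈-tiles⁻ V bs' q))))

-- A symmetric relation becomes a bit list by marking the dominoes on which it holds; unfolding and
-- folding both build their output this way.
module _ (V : List Sq) {P : Sq → Sq → Set} (P? : ∀ a b → Dec (P a b)) where

  private
    onDomino? : (d : Domino) → Dec (P (proj₁ d) (proj₂ d))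
    onDomino? (a , b) = P? a b

  graph : List Bool
  graph = indicator onDomino? (dominoes V)

  graph-∈ : graph ∈ allBits (length (dominoes V))
  graph-∈ = indicator-∈-allBits onDomino? (dominoes V)

  edge-graph⁺ : (∀ {a b} → P a b → P b a) →
    ∀ {a b} → a ∈ V → b ∈ V → Adj a b → P a b → Edge (tiles V graph) a b
  edge-graph⁺ P-sym a∈ b∈ (inj₁ q) p =
    inj₁ (∈-select-indicator⁺ onDomino? (∈-dominoes⁺ V a∈ b∈ q) p)
  edge-graph⁺ P-sym a∈ b∈ (inj₂ q) p =
    inj₂ (∈-select-indicator⁺ onDomino? (∈-dominoes⁺ V b∈ a∈ q) (P-sym p))

  edge-graph⁻ : (∀ {a b} → P a b → P b a) → ∀ {a b} → Edge (tiles V graph) a b → P a b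
  edge-graph⁻ P-sym (inj₁ m) = proj₂ (∈-select-indicator⁻ onDomino? {dominoes V} m)
  edge-graph⁻ P-sym (inj₂ m) = P-sym (proj₂ (∈-select-indicator⁻ onDomino? {dominoes V} m))

-- Tilings as perfect pairings

HasPartner : List Domino → Sq → Set
HasPartner T v = ∃ λ u → Edge T v u × (∀ {u'} → Edge T v u' → u' ≡ u)

Pairing : List Sq → List Domino → Set
Pairing V T = ∀ {v} → v ∈ V → HasPartner T v

partner-unique : ∀ {V T} → Pairing V T → ∀ {v u u'} → v ∈ V → Edge T v u → Edge T v u' → u ≡ u'
partner-unique π v∈ e e' with π v∈
... | _ , _ , only = trans (only e) (sym (only e'))

tiling⇒pairing : ∀ {V T} → IsTiling V T → Pairing V T
tiling⇒pairing {V} {T} t {v} v∈ with length-1⁻ {xs = filter (λ d → covers? d v) T} (All.lookup t v∈)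
... | (a , b) , d∈ , only with ∈-filter⁻ (λ d → covers? d v) {xs = T} d∈
...   | d∈T , inj₁ refl = b , inj₁ d∈T , unique
  where
  unique : ∀ {u'} → Edge T v u' → u' ≡ b
  unique (inj₁ m) = cong proj₂ (only (∈-filter⁺ (λ d → covers? d v) m (inj₁ refl)))
  -- The only covering domino would be both (u', v) and (v, b), which forces u' = v = b.
  unique (inj₂ m) with only (∈-filter⁺ (λ d → covers? d v) m (inj₂ refl))
  ... | refl = refl
...   | d∈T , inj₂ refl = a , inj₂ d∈T , unique
  where
  unique : ∀ {u'} → Edge T v u' → u' ≡ a
  unique (inj₂ m) = cong proj₁ (only (∈-filter⁺ (λ d → covers? d v) m (inj₂ refl)))
  unique (inj₁ m) with only (∈-filter⁺ (λ d → covers? d v) m (inj₁ refl))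
  ... | refl = refl

pairing⇒tiling : ∀ {V} → Unique V → ∀ bs → Pairing V (tiles V bs) → IsTiling V (tiles V bs)
pairing⇒tiling {V} uV bs π = All.tabulate λ {v} v∈ → one v (π v∈)
  where
  T = tiles V bs
  one : ∀ v → HasPartner T v → length (filter (λ d → covers? d v) T) ≡ 1
  one v (u , e , only) = go e
    where
    covers-v : ∀ d → Dec (Covers d v)
    covers-v d = covers? d v
    go : Edge T v u → length (filter covers-v T) ≡ 1
    go (inj₁ m) = length-1⁺ (Uniq.filter⁺ covers-v (select-Unique (dominoes-Unique uV) bs))
      (∈-filter⁺ covers-v m (inj₁ refl)) (unique ∘ ∈-filter⁻ covers-v {xs = T})
      where
      unique : ∀ {d} → d ∈ T × Covers d v → d ≡ (v , u)
      unique (m' , inj₁ refl) = cong (v ,_) (only (inj₁ m'))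
      -- A domino with `v` as second end would be (u, v), the reverse of the selected (v, u),
      -- against asymmetry of `⋖`.
      unique (m' , inj₂ refl) with only (inj₂ m')
      ... | refl = ⊥-elim (⋖-asym (proj₂ (proj₂ (∈-tiles⁻ V bs m))) (proj₂ (proj₂ (∈-tiles⁻ V bs m'))))
    go (inj₂ m) = length-1⁺ (Uniq.filter⁺ covers-v (select-Unique (dominoes-Unique uV) bs))
      (∈-filter⁺ covers-v m (inj₂ refl)) (unique ∘ ∈-filter⁻ covers-v {xs = T})
      where
      unique : ∀ {d} → d ∈ T × Covers d v → d ≡ (u , v)
      unique (m' , inj₂ refl) = cong (_, v) (only (inj₂ m'))
      unique (m' , inj₁ refl) with only (inj₁ m')
      ... | refl = ⊥-elim (⋖-asym (proj₂ (proj₂ (∈-tiles⁻ V bs m))) (proj₂ (proj₂ (∈-tiles⁻ V bs m'))))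

edge-SameDomino⁺ : ∀ {T a b} → Edge T a b → Any (SameDomino (a , b)) T
edge-SameDomino⁺ (inj₁ m) = lose m (inj₁ (refl , refl))
edge-SameDomino⁺ (inj₂ m) = lose m (inj₂ (refl , refl))

edge-SameDomino⁻ : ∀ {T a b} → Any (SameDomino (a , b)) T → Edge T a b
edge-SameDomino⁻ x with find x
... | _ , m , inj₁ (refl , refl) = inj₁ m
... | _ , m , inj₂ (refl , refl) = inj₂ m

EdgePreserving : (Sq → Sq) → List Domino → Set
EdgePreserving g T = ∀ {a b} → Edge T a b → Edge T (g a) (g b)

invariant⇒edgePreserving : ∀ {g T} → Invariant g T → EdgePreserving g T
invariant⇒edgePreserving (p , _) (inj₁ m) = edge-SameDomino⁻ (All.lookup p m)
invariant⇒edgePreserving (p , _) (inj₂ m) = Edge-sym (edge-SameDomino⁻ (All.lookup p m))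

-- As `g` is its own inverse, the image of a domino under `g` also serves as the preimage demanded
-- by the second half of `Invariant`.
edgePreserving⇒invariant : ∀ {g T} → (∀ a → g (g a) ≡ a) → EdgePreserving g T → Invariant g T
edgePreserving⇒invariant {g} {T} gg f =
    All.tabulate (λ m → edge-SameDomino⁺ (f (inj₁ m)))
  , All.tabulate (λ m → preimage (f (inj₁ m)))
  where
  preimage : ∀ {a b} → Edge T (g a) (g b) → Any (λ e → SameDomino (a , b) (mapDomino g e)) T
  preimage (inj₁ m) = lose m (inj₁ (sym (gg _) , sym (gg _)))
  preimage (inj₂ m) = lose m (inj₂ (sym (gg _) , sym (gg _)))

length-cartesianProduct : {A B : Set} (xs : List A) (ys : List B) →
  length (cartesianProduct xs ys) ≡ length xs * length ys
length-cartesianProduct []       ys = refl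
length-cartesianProduct (x ∷ xs) ys = trans (length-++ (map (x ,_) ys))
  (cong₂ _+_ (length-map (x ,_) ys) (length-cartesianProduct xs ys))

∈-deleteSet⁺ : ∀ {S V v} → v ∈ V → v ∉ S → v ∈ deleteSet S V
∈-deleteSet⁺ {S} = ∈-filter⁺ (λ v → ¬? (v ∈? S))

∈-deleteSet⁻ : ∀ {S V v} → v ∈ deleteSet S V → v ∈ V × v ∉ S
∈-deleteSet⁻ {S} {V} = ∈-filter⁻ (λ v → ¬? (v ∈? S)) {xs = V}

-- Folding and unfolding

-- When c is deleted, the mark says whether its domino crosses x = 0 (true) or y = 0
-- (false); otherwise only the dummy value true is allowed.
marks : List Sq → List Bool
marks S with cSq ∈? S
... | yes _ = true ∷ false ∷ []
... | no  _ = true ∷ []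

length-marks : ∀ S → length (marks S) ≡ w S
length-marks S with cSq ∈? S
... | yes _ = refl
... | no  _ = refl

marks-Unique : ∀ S → Unique (marks S)
marks-Unique S with cSq ∈? S
... | yes _ = ((λ ()) ∷ []) ∷ [] ∷ []
... | no  _ = [] ∷ []

true-∈-marks : ∀ S → true ∈ marks S
true-∈-marks S with cSq ∈? S
... | yes _ = here refl
... | no  _ = here refl

∈-marks⁺ : ∀ {S} k → cSq ∈ S → k ∈ marks S
∈-marks⁺ {S} k c∈ with cSq ∈? S
∈-marks⁺ true  c∈ | yes _ = here refl
∈-marks⁺ false c∈ | yes _ = there (here refl)
∈-marks⁺ k     c∈ | no c∉ = ⊥-elim (c∉ c∈)

∈-marks⁻ : ∀ {S k} → cSq ∉ S → k ∈ marks S → k ≡ true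
∈-marks⁻ {S} c∉ m with cSq ∈? S
∈-marks⁻ c∉ m          | yes c∈ = ⊥-elim (c∉ c∈)
∈-marks⁻ c∉ (here e)   | no _   = e

not-does-∈-marks : ∀ {S} {E : Set} (E? : Dec E) → (E → cSq ∈ S) → not (does E?) ∈ marks S
not-does-∈-marks     (yes e) f = ∈-marks⁺ false (f e)
not-does-∈-marks {S} (no _)  f = true-∈-marks S

-- A condition only on the orbit of `cSq`: there the mark `true` asks for a common row (crossing x =
-- 0) and `false` for a common column (crossing y = 0).
Orient : Bool → Sq → Sq → Set
Orient k a b = fold a ≢ cSq ⊎ (k ≡ true × proj₂ a ≡ proj₂ b) ⊎ (k ≡ false × proj₁ a ≡ proj₁ b)

Cross : List Sq → Bool → Sq → Sq → Set
Cross S k a b = fold a ≡ fold b × fold a ∈ S × Orient k a b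

-- Stated through `fold` on all pairs of squares, which makes invariance under both reflections
-- immediate.
Unfolded : List Sq → Bool → List Domino → Sq → Sq → Set
Unfolded S k μ a b = Edge μ (fold a) (fold b) ⊎ Cross S k a b

unfolded? : ∀ S k μ a b → Dec (Unfolded S k μ a b)
unfolded? S k μ a b = edge? μ (fold a) (fold b) ⊎-dec
  ((fold a ≟Sq fold b) ×-dec (fold a ∈? S) ×-dec
   (¬? (fold a ≟Sq cSq) ⊎-dec (((k Bool.≟ true) ×-dec (proj₂ a ℤ.≟ proj₂ b)) ⊎-dec
                               ((k Bool.≟ false) ×-dec (proj₁ a ℤ.≟ proj₁ b)))))

Orient-sym : ∀ {k} a b → fold a ≡ fold b → Orient k a b → Orient k b a
Orient-sym a b e (inj₁ n)              = inj₁ (n ∘ trans e)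
Orient-sym a b e (inj₂ (inj₁ (p , q))) = inj₂ (inj₁ (p , sym q))
Orient-sym a b e (inj₂ (inj₂ (p , q))) = inj₂ (inj₂ (p , sym q))

Unfolded-sym : ∀ {S k μ} a b → Unfolded S k μ a b → Unfolded S k μ b a
Unfolded-sym a b (inj₁ e) = inj₁ (Edge-sym e)
Unfolded-sym {S} a b (inj₂ (e , m , o)) =
  inj₂ (sym e , subst (_∈ S) e m , Orient-sym a b e o)

module _ (g : Sq → Sq) (fold-g : ∀ v → fold (g v) ≡ fold v) (a b : Sq)
         (columns : proj₁ a ≡ proj₁ b → proj₁ (g a) ≡ proj₁ (g b))
         (rows    : proj₂ a ≡ proj₂ b → proj₂ (g a) ≡ proj₂ (g b)) where

  Orient-map : ∀ {k} → Orient k a b → Orient k (g a) (g b)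
  Orient-map (inj₁ n)              = inj₁ (n ∘ trans (sym (fold-g a)))
  Orient-map (inj₂ (inj₁ (x , y))) = inj₂ (inj₁ (x , rows y))
  Orient-map (inj₂ (inj₂ (x , y))) = inj₂ (inj₂ (x , columns y))

  Unfolded-map : ∀ {S k μ} → Unfolded S k μ a b → Unfolded S k μ (g a) (g b)
  Unfolded-map {μ = μ} (inj₁ e) = inj₁ (subst₂ (Edge μ) (sym (fold-g a)) (sym (fold-g b)) e)
  Unfolded-map {S} (inj₂ (e , m , o)) =
    inj₂ (trans (fold-g a) (trans e (sym (fold-g b))) , subst (_∈ S) (sym (fold-g a)) m , Orient-map o)

Unfolded-tSq : ∀ {S k μ} a b → Unfolded S k μ a b → Unfolded S k μ (tSq a) (tSq b)
Unfolded-tSq a b = Unfolded-map tSq fold-tSq a b (cong mirror) (λ e → e)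

Unfolded-uSq : ∀ {S k μ} a b → Unfolded S k μ a b → Unfolded S k μ (uSq a) (uSq b)
Unfolded-uSq a b = Unfolded-map uSq fold-uSq a b (λ e → e) (cong mirror)

HasPartner-map : ∀ {T g} → (∀ v → g (g v) ≡ v) → EdgePreserving g T →
  ∀ v → HasPartner T v → HasPartner T (g v)
HasPartner-map {T} {g} gg f v (u , e , only) = g u , f e , λ {u'} e' →
  trans (sym (gg u')) (cong g (only (subst (λ x → Edge T x (g u')) (gg v) (f e'))))

-- The correspondence over an arbitrary doubly symmetric region

data Axial : Sq → Set where
  column : ∀ b → Axial (-[1+ 0 ] , + b)
  row    : ∀ a → Axial (-[1+ suc a ] , + 0)

record Symmetric (AD Q D : List Sq) : Set where
  field
    AD-unique : Unique AD
    Q-unique  : Unique Q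
    D-unique  : Unique D
    AD-tSq    : ∀ {v} → v ∈ AD → tSq v ∈ AD
    AD-uSq    : ∀ {v} → v ∈ AD → uSq v ∈ AD
    quad-∈⁺      : ∀ {v} → Quad v → v ∈ AD → v ∈ Q
    quad-∈⁻      : ∀ {v} → v ∈ Q → Quad v × v ∈ AD
    D⊆AD      : ∀ {v} → v ∈ D → v ∈ AD
    D-Axial   : ∀ {v} → v ∈ D → Axial v
    column-∈  : ∀ b → (-[1+ 0 ] , + b) ∈ AD → (-[1+ 0 ] , + b) ∈ D
    row-∈     : ∀ a → (-[1+ a ] , + 0) ∈ AD → (-[1+ a ] , + 0) ∈ D

module _ {AD Q D : List Sq} (sym-AD : Symmetric AD Q D) where

  open Symmetric sym-AD

  chosen : List Bool → List Sq
  chosen bs = select D bs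

  region : List Bool → List Sq
  region bs = deleteSet (chosen bs) Q

  Config : Set
  Config = List Bool × Bool × List Bool

  completions : List Bool → List (Bool × List Bool)
  completions bs = cartesianProduct (marks (chosen bs))
    (filter (pm? (region bs)) (allBits (length (dominoes (region bs)))))

  configs : List Config
  configs = concatMap (λ bs → map (bs ,_) (completions bs)) (allBits (length D))

  -- Marks and matchings are chosen independently once the subset is fixed, and there are `w`
  -- admissible marks.
  length-configs : length configs ≡ sum (map (λ bs → w (chosen bs) * M (region bs)) (allBits (length D)))
  length-configs = trans (length-concatMap (λ bs → map (bs ,_) (completions bs)) (allBits (length D)))
    (cong sum (map-cong pointwise (allBits (length D))))
    where
    pointwise : ∀ bs → length (map (bs ,_) (completions bs)) ≡ w (chosen bs) * M (region bs)
    pointwise bs = trans (length-map (bs ,_) (completions bs))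
      (trans (length-cartesianProduct (marks (chosen bs)) _)
             (cong (_* M (region bs)) (length-marks (chosen bs))))

  configs-Unique : Unique configs
  configs-Unique = concatMap-Unique proj₁ (λ m → cong proj₁ (proj₂ (proj₂ (∈-map⁻ _ m))))
    (λ bs → Uniq.map⁺ (cong proj₂) (Uniq.cartesianProduct⁺ (marks-Unique (chosen bs))
      (Uniq.filter⁺ (pm? (region bs)) (allBits-Unique (length (dominoes (region bs)))))))
    (allBits-Unique (length D))

  ValidConfig : Config → Set
  ValidConfig (bs , k , cs) = bs ∈ allBits (length D) × k ∈ marks (chosen bs) ×
    cs ∈ allBits (length (dominoes (region bs))) × IsTiling (region bs) (tiles (region bs) cs)

  ∈-configs⁺ : ∀ {x} → ValidConfig x → x ∈ configs
  ∈-configs⁺ {bs , k , cs} (bs∈ , k∈ , cs∈ , t) =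
    ∈-concatMap⁺ (λ bs → map (bs ,_) (completions bs)) (lose bs∈
      (∈-map⁺ (bs ,_) (∈-cartesianProduct⁺ k∈ (∈-filter⁺ (pm? (region bs)) cs∈ t))))

  ∈-configs⁻ : ∀ {x} → x ∈ configs → ValidConfig x
  ∈-configs⁻ m with find (∈-concatMap⁻ (λ bs → map (bs ,_) (completions bs)) {xs = allBits (length D)} m)
  ... | bs , bs∈ , m' with ∈-map⁻ (bs ,_) m'
  ...   | (k , cs) , m'' , refl with ∈-cartesianProduct⁻ (marks (chosen bs)) _ m''
  ...     | k∈ , cs∈' with ∈-filter⁻ (pm? (region bs)) {xs = allBits (length (dominoes (region bs)))} cs∈'
  ...       | cs∈ , t = bs∈ , k∈ , cs∈ , t

  region-Unique : ∀ bs → Unique (region bs)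
  region-Unique bs = Uniq.filter⁺ (λ v → ¬? (v ∈? chosen bs)) Q-unique

  ∈-region⁺ : ∀ bs {v} → Quad v → v ∈ AD → v ∉ chosen bs → v ∈ region bs
  ∈-region⁺ bs q m v∉ = ∈-deleteSet⁺ {chosen bs} (quad-∈⁺ q m) v∉

  ∈-region⁻ : ∀ bs {v} → v ∈ region bs → Quad v × v ∈ AD × v ∉ chosen bs
  ∈-region⁻ bs m with ∈-deleteSet⁻ {chosen bs} {Q} m
  ... | m' , v∉ with quad-∈⁻ m'
  ...   | q , m'' = q , m'' , v∉

  ∈-chosen⁻ : ∀ bs {v} → v ∈ chosen bs → v ∈ D
  ∈-chosen⁻ bs m = select-⊆ D bs m

  SymTilingOf : List Bool → Set
  SymTilingOf ts = PerfectMatching AD ts × Invariant tSq (tiles AD ts) × Invariant r2Sq (tiles AD ts)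

  UnfoldedBy : Config → Sq → Sq → Set
  UnfoldedBy (bs , k , cs) = Unfolded (chosen bs) k (tiles (region bs) cs)

  -- Adjacency is part of the comparison because `Cross` also relates non-adjacent squares of one
  -- orbit.
  Unfolds : Config → List Bool → Set
  Unfolds x ts = ∀ {a b} → a ∈ AD → b ∈ AD → Adj a b →
    (Edge (tiles AD ts) a b → UnfoldedBy x a b) × (UnfoldedBy x a b → Edge (tiles AD ts) a b)

  Cross⇒¬Quad : ∀ {S k v u} → Quad v → Adj v u → Cross S k v u → ¬ Quad u
  Cross⇒¬Quad (quad a b) adj (e , _) (quad a' b') with e
  ... | refl = Adj-irrefl adj

  -- At `cSq` the mark selects the axis; any other axial square touches just one, and the
  -- orientation condition holds vacuously.
  Cross-exists : ∀ {S v} k → Axial v → v ∈ AD → v ∈ S → ∃ λ u → u ∈ AD × Adj v u × Cross S k v u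
  Cross-exists true  (column zero) v∈ m = _ , AD-tSq v∈ , Adj-acrossX 0 , refl , m , inj₂ (inj₁ (refl , refl))
  Cross-exists false (column zero) v∈ m = _ , AD-uSq v∈ , Adj-acrossY 0 , refl , m , inj₂ (inj₂ (refl , refl))
  Cross-exists k (column (suc b))  v∈ m = _ , AD-tSq v∈ , Adj-acrossX (suc b) , refl , m , inj₁ λ ()
  Cross-exists k (row a)           v∈ m = _ , AD-uSq v∈ , Adj-acrossY (suc a) , refl , m , inj₁ λ ()

  Cross-XY : ∀ {S k} → Cross S k cSq (tSq cSq) → ¬ Cross S k cSq (uSq cSq)
  Cross-XY (_ , _ , inj₁ x)                   _                              = x refl
  Cross-XY _                                  (_ , _ , inj₁ x)               = x refl
  Cross-XY (_ , _ , inj₂ (inj₁ (refl , _)))   (_ , _ , inj₂ (inj₁ (_ , ())))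
  Cross-XY (_ , _ , inj₂ (inj₁ (refl , _)))   (_ , _ , inj₂ (inj₂ (() , _)))
  Cross-XY (_ , _ , inj₂ (inj₂ (_ , ())))     _

  -- Crossings in two directions are possible only at `cSq`, where they would require opposite
  -- marks.
  Cross-unique : ∀ {S k v u u'} → Quad v → Adj v u → Adj v u' → Cross S k v u → Cross S k v u' → u' ≡ u
  Cross-unique q p p' c c' with neighbour q p | neighbour q p'
  ... | inside r  | _          = ⊥-elim (Cross⇒¬Quad q p c r)
  ... | acrossX _ | inside r'  = ⊥-elim (Cross⇒¬Quad q p' c' r')
  ... | acrossY _ | inside r'  = ⊥-elim (Cross⇒¬Quad q p' c' r')
  ... | acrossX b | acrossX .b = refl
  ... | acrossY a | acrossY .a = refl
  ... | acrossX _ | acrossY _  = ⊥-elim (Cross-XY c c')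
  ... | acrossY _ | acrossX _  = ⊥-elim (Cross-XY c' c)

  -- From a configuration to a symmetric tiling

  module Unfold (bs : List Bool) (k : Bool) (cs : List Bool)
                (t : IsTiling (region bs) (tiles (region bs) cs)) where

    private
      S : List Sq
      S = chosen bs
      V : List Sq
      V = region bs
      μ : List Domino
      μ = tiles V cs
      P? : ∀ a b → Dec (Unfolded S k μ a b)
      P? = unfolded? S k μ
      P-sym : ∀ {a b} → Unfolded S k μ a b → Unfolded S k μ b a
      P-sym {a} {b} = Unfolded-sym a b

    unfolded : List Bool
    unfolded = graph AD P?

    private
      T : List Domino
      T = tiles AD unfolded

    edge-unfolded⁺ : ∀ {a b} → a ∈ AD → b ∈ AD → Adj a b → Unfolded S k μ a b → Edge T a b
    edge-unfolded⁺ = edge-graph⁺ AD P? (λ {a} {b} → P-sym {a} {b})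

    edge-unfolded⁻ : ∀ {a b} → Edge T a b → Unfolded S k μ a b
    edge-unfolded⁻ = edge-graph⁻ AD P? (λ {a} {b} → P-sym {a} {b})

    unfolded-Unfolds : Unfolds (bs , k , cs) unfolded
    unfolded-Unfolds a∈ b∈ p = edge-unfolded⁻ , edge-unfolded⁺ a∈ b∈ p

    preserves-tSq : EdgePreserving tSq T
    preserves-tSq {a} {b} e with edge⁻ AD unfolded e
    ... | a∈ , b∈ , p = edge-unfolded⁺ (AD-tSq a∈) (AD-tSq b∈) (Adj-tSq p)
      (Unfolded-tSq a b (edge-unfolded⁻ e))

    preserves-uSq : EdgePreserving uSq T
    preserves-uSq {a} {b} e with edge⁻ AD unfolded e
    ... | a∈ , b∈ , p = edge-unfolded⁺ (AD-uSq a∈) (AD-uSq b∈) (Adj-uSq p)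
      (Unfolded-uSq a b (edge-unfolded⁻ e))

    pairing-chosen : ∀ {v} → Quad v → v ∈ AD → v ∈ S → HasPartner T v
    pairing-chosen q@(quad a b) v∈ v∈S with Cross-exists k (D-Axial (∈-chosen⁻ bs v∈S)) v∈ v∈S
    ... | u , u∈ , p , c = u , edge-unfolded⁺ v∈ u∈ p (inj₂ c) , only
      where
      only : ∀ {u'} → Edge T (-[1+ a ] , + b) u' → u' ≡ u
      only e with edge-unfolded⁻ e
      -- A matching edge would put the square in the region, from which the chosen squares are
      -- deleted.
      ... | inj₁ e' = ⊥-elim (proj₂ (proj₂ (∈-region⁻ bs (proj₁ (edge⁻ V cs e')))) v∈S)
      ... | inj₂ c' = Cross-unique q p (edge-Adj AD unfolded e) c c'

    pairing-unchosen : ∀ {v} → Quad v → v ∈ AD → v ∉ S → HasPartner T v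
    pairing-unchosen q@(quad a b) v∈ v∉S with tiling⇒pairing t (∈-region⁺ bs q v∈ v∉S)
    ... | x , e , only with edge⁻ V cs e
    ...   | _ , x∈V , p with ∈-region⁻ bs x∈V
    ...     | qx , x∈ , _ = x , edge-unfolded⁺ v∈ x∈ p
                  (inj₁ (subst (Edge μ _) (sym (fold-quad qx)) e)) , only'
      where
      only' : ∀ {u'} → Edge T (-[1+ a ] , + b) u' → u' ≡ x
      only' e' with edge-unfolded⁻ e'
      ... | inj₂ (_ , v∈S , _) = ⊥-elim (v∉S v∈S)
      ... | inj₁ f with neighbour q (edge-Adj AD unfolded e')
      ...   | inside q' = only (subst (Edge μ _) (fold-quad q') f)
      -- Both ends of a crossing pair fold to one square, and the matching has no loops.
      ...   | acrossX _ = ⊥-elim (Adj-irrefl (edge-Adj V cs f))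
      ...   | acrossY _ = ⊥-elim (Adj-irrefl (edge-Adj V cs f))

    pairing : Pairing AD T
    pairing {v} = quad-wlog {λ v → v ∈ AD → HasPartner T v}
      (λ v h m → HasPartner-map {g = tSq} tSq-involutive preserves-tSq v
        (h (subst (_∈ AD) (tSq-involutive v) (AD-tSq m))))
      (λ v h m → HasPartner-map {g = uSq} uSq-involutive preserves-uSq v
        (h (subst (_∈ AD) (uSq-involutive v) (AD-uSq m))))
      base v
      where
      base : ∀ {v} → Quad v → v ∈ AD → HasPartner T v
      base {v} q m with v ∈? S
      ... | yes v∈S = pairing-chosen q m v∈S
      ... | no  v∉S = pairing-unchosen q m v∉S

    symTiling : SymTilingOf unfolded
    symTiling = pairing⇒tiling (AD-unique) unfolded pairing
      , edgePreserving⇒invariant tSq-involutive preserves-tSq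
      -- The rotation is the composite of the two reflections.
      , edgePreserving⇒invariant r2Sq-involutive (preserves-tSq ∘ preserves-uSq)
      where
      r2Sq-involutive : ∀ v → r2Sq (r2Sq v) ≡ v
      r2Sq-involutive (i , j) = cong₂ _,_ (mirror-involutive i) (mirror-involutive j)

  -- From a symmetric tiling to a configuration

  module Fold (ts : List Bool) (st : SymTilingOf ts) where

    private
      T : List Domino
      T = tiles AD ts

    T-pairing : Pairing AD T
    T-pairing = tiling⇒pairing (proj₁ st)

    unique : ∀ {v u u'} → Edge T v u → Edge T v u' → u ≡ u'
    unique e = partner-unique {AD} T-pairing (proj₁ (edge⁻ AD ts e)) e

    T-tSq : EdgePreserving tSq T
    T-tSq = invariant⇒edgePreserving (proj₁ (proj₂ st))

    T-uSq : EdgePreserving uSq T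
    T-uSq {a} {b} e = subst₂ (Edge T) (via a) (via b)
      (invariant⇒edgePreserving (proj₂ (proj₂ st)) (T-tSq e))
      where
      via : ∀ v → r2Sq (tSq v) ≡ uSq v
      via (i , j) = cong (_, mirror j) (mirror-involutive i)

    Crossed : Sq → Set
    Crossed v = Edge T v (tSq v) ⊎ Edge T v (uSq v)

    crossed? : ∀ v → Dec (Crossed v)
    crossed? v = edge? T v (tSq v) ⊎-dec edge? T v (uSq v)

    bs : List Bool
    bs = indicator crossed? D

    -- The value is `true` also when `cSq` is not chosen, which is the dummy mark required in that
    -- case.
    k : Bool
    k = not (does (edge? T cSq (uSq cSq)))

    private
      S : List Sq
      S = chosen bs
      V : List Sq
      V = region bs

    cs : List Bool
    cs = graph V (edge? T)

    private
      μ : List Domino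
      μ = tiles V cs

    chosen⁺ : ∀ {v} → v ∈ D → Crossed v → v ∈ S
    chosen⁺ d c = ∈-select-indicator⁺ crossed? d c

    chosen⁻ : ∀ {v} → v ∈ S → Crossed v
    chosen⁻ m = proj₂ (∈-select-indicator⁻ crossed? {D} m)

    acrossX-chosen : ∀ {b} → Edge T (-[1+ 0 ] , + b) (tSq (-[1+ 0 ] , + b)) → (-[1+ 0 ] , + b) ∈ S
    acrossX-chosen e = chosen⁺ (column-∈ _ (proj₁ (edge⁻ AD ts e))) (inj₁ e)

    acrossY-chosen : ∀ {a} → Edge T (-[1+ a ] , + 0) (uSq (-[1+ a ] , + 0)) → (-[1+ a ] , + 0) ∈ S
    acrossY-chosen {a} e = chosen⁺ (row-∈ a (proj₁ (edge⁻ AD ts e))) (inj₂ e)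

    -- A chosen square has a mirror image as its unique partner, and that lies outside the quadrant.
    inside-unchosen : ∀ {v u} → Quad v → Quad u → Edge T v u → v ∉ S
    inside-unchosen qv qu e m with chosen⁻ m
    ... | inj₁ c = ¬Quad-tSq qv (subst Quad (unique e c) qu)
    ... | inj₂ c = ¬Quad-uSq qv (subst Quad (unique e c) qu)

    edge-μ⁺ : ∀ {v u} → Quad v → Quad u → Edge T v u → Edge μ v u
    edge-μ⁺ qv qu e with edge⁻ AD ts e
    ... | v∈ , u∈ , p = edge-graph⁺ V (edge? T) Edge-sym
      (∈-region⁺ bs qv v∈ (inside-unchosen qv qu e))
      (∈-region⁺ bs qu u∈ (inside-unchosen qu qv (Edge-sym e))) p e

    edge-μ⁻ : ∀ {v u} → Edge μ v u → Edge T v u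
    edge-μ⁻ = edge-graph⁻ V (edge? T) Edge-sym

    pairing : Pairing V μ
    pairing v∈V with ∈-region⁻ bs v∈V
    ... | q , v∈ , v∉S with T-pairing v∈
    ...   | u , e , only with neighbour q (edge-Adj AD ts e)
    ...     | inside q' = u , edge-μ⁺ q q' e , only ∘ edge-μ⁻
    ...     | acrossX _ = ⊥-elim (v∉S (acrossX-chosen e))
    ...     | acrossY _ = ⊥-elim (v∉S (acrossY-chosen e))

    k-true : ¬ Edge T cSq (uSq cSq) → k ≡ true
    k-true ne = cong not (dec-false (edge? T cSq (uSq cSq)) ne)

    k-false : Edge T cSq (uSq cSq) → k ≡ false
    k-false e = cong not (dec-true (edge? T cSq (uSq cSq)) e)

    k-∈ : k ∈ marks S
    k-∈ = not-does-∈-marks (edge? T cSq (uSq cSq)) acrossY-chosen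

    valid : ValidConfig (bs , k , cs)
    valid = indicator-∈-allBits crossed? D , k-∈ , graph-∈ V (edge? T)
      , pairing⇒tiling (region-Unique bs) cs pairing

    orientX : ∀ b → Edge T (-[1+ 0 ] , + b) (tSq (-[1+ 0 ] , + b)) →
      Orient k (-[1+ 0 ] , + b) (tSq (-[1+ 0 ] , + b))
    -- The two mirror images of `cSq` differ, so a partner across x = 0 excludes one across y = 0.
    orientX zero    e = inj₂ (inj₁ (k-true (λ e' → tSq≢uSq (quad 0 0) (unique e e')) , refl))
    orientX (suc b) e = inj₁ λ ()

    orientY : ∀ a → Edge T (-[1+ a ] , + 0) (uSq (-[1+ a ] , + 0)) →
      Orient k (-[1+ a ] , + 0) (uSq (-[1+ a ] , + 0))
    orientY zero    e = inj₂ (inj₂ (k-false e , refl))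
    orientY (suc a) e = inj₁ λ ()

    crossing : ∀ {v u} → Quad v → Edge T v u → ¬ Quad u → Cross S k v u
    crossing q e ¬q with neighbour q (edge-Adj AD ts e)
    ... | inside q' = ⊥-elim (¬q q')
    ... | acrossX b = refl , acrossX-chosen e , orientX b e
    ... | acrossY a = refl , acrossY-chosen e , orientY a e

    chosen-crossing : ∀ {v} → Quad v → v ∈ S → ∃ λ u → Edge T v u × Cross S k v u
    chosen-crossing q m with chosen⁻ m
    ... | inj₁ e = _ , e , crossing q e (¬Quad-tSq q)
    ... | inj₂ e = _ , e , crossing q e (¬Quad-uSq q)

    folded⁺ : ∀ {a b} → Quad a → Edge T a b → UnfoldedBy (bs , k , cs) a b
    folded⁺ {a} {b} q e with neighbour q (edge-Adj AD ts e)
    ... | inside q' = inj₁ (subst₂ (Edge μ) (sym (fold-quad q)) (sym (fold-quad q')) (edge-μ⁺ q q' e))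
    ... | acrossX _ = inj₂ (crossing q e (¬Quad-tSq q))
    ... | acrossY _ = inj₂ (crossing q e (¬Quad-uSq q))

    folded⁻ : ∀ {a b} → Quad a → Adj a b → UnfoldedBy (bs , k , cs) a b → Edge T a b
    folded⁻ q@(quad _ _) p (inj₂ c@(_ , m , _)) with chosen-crossing q m
    -- The given pair and the actual domino of the chosen square are both crossings, hence they
    -- coincide.
    ... | u , e , c' = subst (Edge T _) (sym (Cross-unique q (edge-Adj AD ts e) p c' c)) e
    folded⁻ q@(quad _ _) p (inj₁ f) with neighbour q p
    ... | inside q' = edge-μ⁻ (subst (Edge μ _) (fold-quad q') f)
    ... | acrossX _ = ⊥-elim (Adj-irrefl (edge-Adj V cs f))
    ... | acrossY _ = ⊥-elim (Adj-irrefl (edge-Adj V cs f))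

    Agree : Sq → Set
    Agree a = ∀ {b} → Adj a b →
      (Edge T a b → UnfoldedBy (bs , k , cs) a b) × (UnfoldedBy (bs , k , cs) a b → Edge T a b)

    -- A pair starting at `g a` is reflected to one starting at `a`, compared there, and reflected
    -- back.
    agree-map : (g : Sq → Sq) → (∀ v → g (g v) ≡ v) → EdgePreserving g T →
      (∀ {a b} → Adj a b → Adj (g a) (g b)) →
      (∀ a b → UnfoldedBy (bs , k , cs) a b → UnfoldedBy (bs , k , cs) (g a) (g b)) →
      ∀ a → Agree a → Agree (g a)
    agree-map g gg T-g Adj-g P-g a h {b} p =
        (λ e → subst (UnfoldedBy (bs , k , cs) (g a)) (gg b)
                 (P-g a (g b) (proj₁ (h p') (subst (λ x → Edge T x (g b)) (gg a) (T-g e)))))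
      , (λ f → subst (Edge T (g a)) (gg b)
                 (T-g (proj₂ (h p') (subst (λ x → UnfoldedBy (bs , k , cs) x (g b)) (gg a) (P-g (g a) b f)))))
      where
      p' : Adj a (g b)
      p' = subst (λ x → Adj x (g b)) (gg a) (Adj-g p)

    folded-Unfolds : Unfolds (bs , k , cs) ts
    folded-Unfolds {a} _ _ p = quad-wlog {Agree}
      (agree-map tSq tSq-involutive T-tSq Adj-tSq Unfolded-tSq)
      (agree-map uSq uSq-involutive T-uSq Adj-uSq Unfolded-uSq)
      (λ q p → folded⁺ q , folded⁻ q p) a p

  Axial-Quad : ∀ {v} → Axial v → Quad v
  Axial-Quad (column b) = quad 0 b
  Axial-Quad (row a)    = quad (suc a) 0

  -- A tiling determines its configuration

  module Determined (ts : List Bool) where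

    -- The crossing pair is an edge of `ts`, so the second configuration accounts for it too; not by
    -- a matching edge, since both ends fold to the same square.
    Cross-transfer : ∀ bs k cs bs' k' cs' → Unfolds (bs , k , cs) ts → Unfolds (bs' , k' , cs') ts →
      ∀ {v u} → v ∈ AD → u ∈ AD → Adj v u → Cross (chosen bs) k v u → Cross (chosen bs') k' v u
    Cross-transfer bs k cs bs' k' cs' r r' v∈ u∈ p c@(e , _) with proj₁ (r' v∈ u∈ p) (proj₂ (r v∈ u∈ p) (inj₂ c))
    ... | inj₂ c' = c'
    ... | inj₁ f  = ⊥-elim (Adj-irrefl (subst (Adj _) (sym e) (edge-Adj (region bs') cs' f)))

    -- The subset is recovered from the tiling as the squares that have a crossing domino.
    chosen-transfer : ∀ bs k cs bs' k' cs' → Unfolds (bs , k , cs) ts → Unfolds (bs' , k' , cs') ts →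
      ∀ {v} → v ∈ chosen bs → v ∈ chosen bs'
    chosen-transfer bs k cs bs' k' cs' r r' m
      with D-Axial (∈-chosen⁻ bs m) | D⊆AD (∈-chosen⁻ bs m)
    ... | ax | v∈ with Cross-exists k ax v∈ m
    ...   | u , u∈ , p , c =
      subst (_∈ chosen bs') (fold-quad (Axial-Quad ax))
        (proj₁ (proj₂ (Cross-transfer bs k cs bs' k' cs' r r' v∈ u∈ p c)))

    -- The pair of `cSq` and its image across x = 0 is the test: it is a crossing under the mark
    -- `true` only.
    mark-transfer : ∀ bs cs bs' k' cs' → Unfolds (bs , true , cs) ts → Unfolds (bs' , k' , cs') ts →
      cSq ∈ chosen bs → k' ≡ true
    mark-transfer bs cs bs' k' cs' r r' m with D⊆AD (∈-chosen⁻ bs m)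
    ... | c∈ with Cross-transfer bs true cs bs' k' cs' r r' c∈ (AD-tSq c∈) (Adj-acrossX 0)
                    (refl , m , inj₂ (inj₁ (refl , refl)))
    ...   | _ , _ , inj₁ x               = ⊥-elim (x refl)
    ...   | _ , _ , inj₂ (inj₁ (e , _))  = e
    ...   | _ , _ , inj₂ (inj₂ (_ , ()))

    mark-unique : ∀ bs k cs k' cs' → k ∈ marks (chosen bs) → k' ∈ marks (chosen bs) →
      Unfolds (bs , k , cs) ts → Unfolds (bs , k' , cs') ts → k ≡ k'
    mark-unique bs k cs k' cs' k∈ k'∈ r r' = go (cSq ∈? chosen bs) k k' k∈ k'∈ r r'
      where
      go : Dec (cSq ∈ chosen bs) → ∀ k k' → k ∈ marks (chosen bs) → k' ∈ marks (chosen bs) →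
        Unfolds (bs , k , cs) ts → Unfolds (bs , k' , cs') ts → k ≡ k'
      go (no c∉)  k     k'    k∈ k'∈ _ _ = trans (∈-marks⁻ {chosen bs} c∉ k∈) (sym (∈-marks⁻ {chosen bs} c∉ k'∈))
      go (yes c∈) true  k'    _ _ r r' = sym (mark-transfer bs cs bs k' cs' r r' c∈)
      go (yes c∈) false true  _ _ r r' = mark-transfer bs cs' bs false cs r' r c∈
      go (yes c∈) false false _ _ r r' = refl

    edge-transfer : ∀ bs k cs k' cs' → Unfolds (bs , k , cs) ts → Unfolds (bs , k' , cs') ts →
      ∀ {a b} → a ∈ region bs → b ∈ region bs → Adj a b →
      Edge (tiles (region bs) cs) a b → Edge (tiles (region bs) cs') a b
    edge-transfer bs k cs k' cs' r r' a∈V b∈V p e with ∈-region⁻ bs a∈V | ∈-region⁻ bs b∈V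
    ... | quad _ _ , a∈ , _ | quad _ _ , b∈ , _
      with proj₁ (r' a∈ b∈ p) (proj₂ (r a∈ b∈ p) (inj₁ e))
    ...   | inj₁ f = f
    ...   | inj₂ (refl , _) = ⊥-elim (Adj-irrefl p)

    config-unique : ∀ {x x'} → ValidConfig x → ValidConfig x' → Unfolds x ts → Unfolds x' ts → x ≡ x'
    config-unique {bs , k , cs} {bs' , k' , cs'} (bs∈ , k∈ , cs∈ , _) (bs'∈ , k'∈ , cs'∈ , _) r r'
      -- The subsets come first: only after they are identified are `cs` and `cs'` bit lists over
      -- the same region.
      with select-injective D-unique bs bs' (∈-allBits⁻ _ bs∈) (∈-allBits⁻ _ bs'∈)
             (chosen-transfer bs k cs bs' k' cs' r r') (chosen-transfer bs' k' cs' bs k cs r' r)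
    ... | refl = cong (bs ,_) (cong₂ _,_ (mark-unique bs k cs k' cs' k∈ k'∈ r r')
      (tiles-injective (region-Unique bs) cs∈ cs'∈
        (edge-transfer bs k cs k' cs' r r') (edge-transfer bs k' cs' k cs r' r)))

  -- Equality of the two counts

  unfolded-unique : ∀ {x ts ts'} → ts ∈ allBits (length (dominoes AD)) → ts' ∈ allBits (length (dominoes AD)) →
    Unfolds x ts → Unfolds x ts' → ts ≡ ts'
  unfolded-unique m m' r r' = tiles-injective AD-unique m m'
    (λ a∈ b∈ p e → proj₂ (r' a∈ b∈ p) (proj₁ (r a∈ b∈ p) e))
    (λ a∈ b∈ p e → proj₂ (r a∈ b∈ p) (proj₁ (r' a∈ b∈ p) e))

  weighted-count : (sym? : Decidable SymTilingOf) →
    sum (map (λ bs → w (chosen bs) * M (region bs)) (allBits (length D)))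
      ≡ length (filter sym? (allBits (length (dominoes AD))))
  weighted-count sym? = trans (sym length-configs)
    (length-≡-by Unfolds configs-Unique (Uniq.filter⁺ sym? (allBits-Unique (length (dominoes AD))))
      unfold-total fold-total
      (λ {_} {_} {ts} m m' → Determined.config-unique ts (∈-configs⁻ m) (∈-configs⁻ m'))
      (λ {x} m m' → unfolded-unique {x} (bits m) (bits m')))
    where
    tilings : List (List Bool)
    tilings = filter sym? (allBits (length (dominoes AD)))
    bits : ∀ {ts} → ts ∈ tilings → ts ∈ allBits (length (dominoes AD))
    bits m = proj₁ (∈-filter⁻ sym? {xs = allBits (length (dominoes AD))} m)
    unfold-total : ∀ {x} → x ∈ configs → ∃ λ ts → ts ∈ tilings × Unfolds x ts
    unfold-total {bs , k , cs} m = unfolded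
      , ∈-filter⁺ sym? (graph-∈ AD (unfolded? (chosen bs) k (tiles (region bs) cs))) symTiling
      , unfolded-Unfolds
      where open Unfold bs k cs (proj₂ (proj₂ (proj₂ (∈-configs⁻ m))))
    fold-total : ∀ {ts} → ts ∈ tilings → ∃ λ x → x ∈ configs × Unfolds x ts
    fold-total {ts} m = _ , ∈-configs⁺ valid , folded-Unfolds
      where open Fold ts (proj₂ (∈-filter⁻ sym? {xs = allBits (length (dominoes AD))} m))

-- The Aztec diamond as an instance

Aztec-symmetric : ∀ n → Symmetric (ADsquares n) (Qsquares n) (distinguished n)
Aztec-symmetric n = record
  { AD-unique = AD-Unique n
  ; Q-unique  = Uniq.filter⁺ inQuadrant? (AD-Unique n)
  ; D-unique  = distinguished-Unique n
  ; AD-tSq    = λ {v} m → ∈-AD⁺ {n} _ (Small-tSq v (∈-AD⁻ {n} m))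
  ; AD-uSq    = λ {v} m → ∈-AD⁺ {n} _ (Small-uSq v (∈-AD⁻ {n} m))
  ; quad-∈⁺   = ∈-Q⁺ {n}
  ; quad-∈⁻   = ∈-Q⁻ {n}
  ; D⊆AD      = λ m → Dist⇒∈-AD (∈-distinguished⁻ {n} m)
  ; D-Axial   = λ m → Dist⇒Axial (∈-distinguished⁻ {n} m)
  ; column-∈  = λ b m → ∈-distinguished⁺ (Dist-column {n} m)
  ; row-∈     = λ a m → ∈-distinguished⁺ (Dist-row {n} a m)
  }
  where
  Dist⇒Axial : ∀ {v} → Dist n v → Axial v
  Dist⇒Axial (column b _) = column b
  Dist⇒Axial (row a _)    = row a

theorem7 : (n : ℕ) → 1 ≤ n → weightedSum n ≡ numSymTilings n
theorem7 n _ = weighted-count (Aztec-symmetric n) (symTiling? n)
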